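{- Let $(S,+)$ be an infinite semigroup with no idempotent element which is left weakly cancellative and right cancellative, and let $\langle x_n\rangle_{n=1}^\infty$ be a sequence in $S$. Then there exists a sum subsystem $\langle y_n\rangle_{n=1}^\infty$ of $\langle x_n\rangle_{n=1}^\infty$ which satisfies uniqueness of finite sums.
   Context: $S$ is left weakly cancellative if for all $a,b\in S$ the set $\{x: a+x=b\}$ is finite; $S$ is right cancellative if for all $a,b$ the set $\{x: x+a=b\}$ has at most one element; $e$ is idempotent if $e+e=e$. $\mathcal{P}_f(\mathbb{N})$ is the set of nonempty finite subsets of $\mathbb{N}=\{1,2,\dots\}$, and $\sum_{n\in H}x_n$ denotes the sum in increasing order of indices. A sequence $\langle y_n\rangle_{n=1}^\infty$ is a sum subsystem of $\langle x_n\rangle_{n=1}^\infty$ if there are $H_n\in\mathcal{P}_f(\mathbb{N})$ with $\max H_n<\min H_{n+1}$ and $y_n=\sum_{t\in H_n}x_t$ for all $n$. A sequence $\langle y_n\rangle_{n=1}^\infty$ satisfies uniqueness of finite sums if for all distinct $H_1,H_2\in\mathcal{P}_f(\mathbb{N})$, $\sum_{n\in H_1}y_n\neq\sum_{n\in H_2}y_n$. -}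

module Defs where

open import Algebra.Bundles using (Semigroup)
import Algebra.Definitions as AlgDefs
open import Data.List.Membership.Setoid using () renaming (_∈_ to Member)
open import Data.List.NonEmpty using (List⁺; toList; foldr₁; map)
open import Data.List.Relation.Unary.Linked using (Linked)
open import Data.Nat.Base using (ℕ; suc; _<_; _⊔_; _⊓_)
open import Data.Product.Base using (_×_; ∃-syntax; Σ-syntax)
open import Level using (Level) renaming (_⊔_ to _⊔ˡ_)
open import Relation.Binary.Bundles using (Setoid)
open import Relation.Binary.PropositionalEquality.Core using (_≢_)
open import Relation.Nullary.Negation.Core using (¬_)
open import Relation.Unary using (Pred; U)

private
  variable
    c ℓ p : Level

-- A nonempty finite set of naturals is represented by its strictly increasing
-- enumeration, which is unique. The field `increasing` is a proposition
-- (Linked.irrelevant), so _≡_ on 𝒫f is equality of sets.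
--
-- Indices start at 0 rather than 1 throughout: index n here plays the role of
-- n + 1 in {1, 2, …}. Only the order of the indices matters.

record 𝒫f : Set where
  constructor mk𝒫f
  field
    elements   : List⁺ ℕ
    increasing : Linked _<_ (toList elements)

open 𝒫f public

max : 𝒫f → ℕ
max H = foldr₁ _⊔_ (elements H)

min : 𝒫f → ℕ
min H = foldr₁ _⊓_ (elements H)

-- Finite up to the setoid equality: some list contains every element
-- satisfying P (it may also contain others).

Finite : (A : Setoid c ℓ) → Pred (Setoid.Carrier A) p → Set (c ⊔ˡ ℓ ⊔ˡ p)
Finite A P = ∃[ xs ] (∀ x → P x → Member A x xs)

module _ (S : Semigroup c ℓ) where

  open Semigroup S renaming (_∙_ to _+_)
  open AlgDefs _≈_ using (_IdempotentOn_)

  Infinite : Set (c ⊔ˡ ℓ)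
  Infinite = ¬ Finite setoid U

  LeftWeaklyCancellative : Set (c ⊔ˡ ℓ)
  LeftWeaklyCancellative = ∀ a b → Finite setoid (λ x → a + x ≈ b)

  RightCancellative : Set (c ⊔ˡ ℓ)
  RightCancellative = AlgDefs.RightCancellative _≈_ _+_

  NoIdempotent : Set (c ⊔ˡ ℓ)
  NoIdempotent = ¬ (∃[ e ] _+_ IdempotentOn e)

  -- `foldr₁` associates to the right and keeps the (increasing) list order.

  ∑ : (ℕ → Carrier) → 𝒫f → Carrier
  ∑ x H = foldr₁ _+_ (map x (elements H))

  SumSubsystem : (y x : ℕ → Carrier) → Set ℓ
  SumSubsystem y x = Σ[ H ∈ (ℕ → 𝒫f) ] (∀ n → max (H n) < min (H (suc n)))
                   × (∀ n → y n ≈ ∑ x (H n))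

  UniqueFiniteSums : (ℕ → Carrier) → Set ℓ
  UniqueFiniteSums y = ∀ H₁ H₂ → H₁ ≢ H₂ → ¬ (∑ y H₁ ≈ ∑ y H₂)

{-# OPTIONS --safe #-}

-- If a + z ≈ z then right cancellation makes a a right identity, hence
-- idempotent; so a + z ≉ z for all a and z. Consequently z may be added to a
-- list of terms with distinct finite sums as soon as z avoids the finite set
-- consisting of these sums and of the solutions of a + z ≈ b for sums a and b.
--
-- The sums x m + x (m + 1) + … + x (m + k) can always avoid a finite set:
-- otherwise two of them agree, which gives s + w ≈ s. Then every multiple of w
-- solves s + z ≈ s, so two multiples of w agree by left weak cancellativity,
-- and p + q ≈ q for some multiples p and q of w, which is excluded.

module Submission where

open import Defs
open import Algebra.Bundles using (Semigroup)
open import Axiom.ExcludedMiddle using (ExcludedMiddle)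
open import Data.Empty using (⊥-elim)
open import Data.Fin.Base using (Fin; toℕ)
open import Data.Fin.Properties using (pigeonhole; ¬∀⟶∃¬)
open import Data.List.Base as List using (List; []; _∷_; _++_; concatMap; length)
import Data.List.Membership.Setoid as Membership
import Data.List.Membership.Setoid.Properties as Membershipₚ
open import Data.List.NonEmpty.Base
  using (List⁺; _∷_; [_]; _∷⁺_; _⁺∷ʳ_; head; toList; foldr₁; map)
open import Data.List.Relation.Unary.Any as Any using (here; there)
import Data.List.Relation.Unary.Any.Properties as Anyₚ
open import Data.List.Relation.Unary.Linked as Linked using (Linked; [-]; _∷_)
open import Data.Nat.Base as ℕ using (ℕ; zero; suc; _≤_; _<_; s≤s)
import Data.Nat.Properties as ℕₚ
open import Data.Product.Base using (_×_; _,_; proj₁; proj₂; ∃-syntax; ∃₂; Σ-syntax)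
open import Function.Base using (_∘_)
open import Level using (Level) renaming (_⊔_ to _⊔ˡ_)
open import Relation.Binary.Bundles using (Setoid)
open import Relation.Binary.PropositionalEquality.Core as ≡ using (_≡_; refl; cong)
import Relation.Binary.Reasoning.Setoid as SetoidReasoning
open import Relation.Nullary.Negation.Core using (¬_)

private
  variable
    c ℓ : Level
    m n : ℕ
    H H₁ H₂ : List⁺ ℕ

-- Blocks of consecutive indices.

interval : ℕ → ℕ → List⁺ ℕ
interval m zero    = [ m ]
interval m (suc k) = m ∷⁺ interval (suc m) k

interval-increasing : ∀ m k → Linked _<_ (toList (interval m k))
interval-increasing m zero            = [-]
-- The tail shows its head only once its length argument is `zero` or `suc`; hence the extra case.
interval-increasing m (suc zero)      = ℕₚ.n<1+n m ∷ [-]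
interval-increasing m (suc k@(suc _)) = ℕₚ.n<1+n m ∷ interval-increasing (suc m) k

intervalSet : ℕ → ℕ → 𝒫f
intervalSet m k = mk𝒫f (interval m k) (interval-increasing m k)

max-interval : ∀ m k → max (intervalSet m k) ≤ k ℕ.+ m
max-interval m zero    = ℕₚ.≤-refl
max-interval m (suc k) = ℕₚ.⊔-lub (ℕₚ.m≤n+m m (suc k))
  (ℕₚ.≤-trans (max-interval (suc m) k) (ℕₚ.≤-reflexive (ℕₚ.+-suc k m)))

min-interval : ∀ m k → m ≤ min (intervalSet m k)
min-interval m zero    = ℕₚ.≤-refl
min-interval m (suc k) =
  ℕₚ.⊓-glb ℕₚ.≤-refl (ℕₚ.≤-trans (ℕₚ.n≤1+n m) (min-interval (suc m) k))

-- Increasing lists with entries below n, built from the last entry, so that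
-- recursion removes the term added last to the sequence.
data Below : ℕ → List⁺ ℕ → Set where
  skip : Below n H → Below (suc n) H
  only : Below (suc n) [ n ]
  snoc : Below n H → Below (suc n) (H ⁺∷ʳ n)

below-raise : ∀ k → Below n H → Below (k ℕ.+ n) H
below-raise zero    b = b
below-raise (suc k) b = skip (below-raise k b)

below-[] : m < n → Below n [ m ]
below-[] m<n = ≡.subst (λ n → Below n _) (ℕₚ.m∸n+n≡m m<n) (below-raise _ only)

-- A new first entry leaves the last one in place, so induction passes through `skip` and `snoc`; a
-- singleton `[ n ]` turns into `[ m ]` with `n` appended.
below-∷⁺ : m < head H → Below n H → Below n (m ∷⁺ H)
below-∷⁺ m<h (skip b) = skip (below-∷⁺ m<h b)
below-∷⁺ m<h only     = snoc (below-[] m<h)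
below-∷⁺ m<h (snoc b) = snoc (below-∷⁺ m<h b)

increasing⇒below : ∀ H → Linked _<_ (toList H) → ∃[ n ] Below n H
increasing⇒below (m ∷ [])    _           = suc m , only
increasing⇒below (m ∷ h ∷ t) (m<h ∷ inc) with n , b ← increasing⇒below (h ∷ t) inc =
  n , below-∷⁺ m<h b

elements-injective : ∀ {A B : 𝒫f} → elements A ≡ elements B → A ≡ B
elements-injective {mk𝒫f H p} {mk𝒫f .H q} refl =
  cong (mk𝒫f H) (Linked.irrelevant ℕₚ.<-irrelevant p q)

-- Sequences and finite lists up to setoid equality.

module _ (A : Setoid c ℓ) where
  open Setoid A using (Carrier; _≈_; trans; sym; reflexive)
  open Membership A using (_∈_; _∉_)

  -- Pigeonhole on positions in `xs`. Writing the later index as `suc (i ℕ.+ j)` makes it strictly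
  -- larger and exposes the gap for later use.
  collision : ∀ xs (f : ℕ → Carrier) → (∀ (i : Fin (suc (length xs))) → f (toℕ i) ∈ xs) →
              ∃₂ λ i j → f i ≈ f (suc (i ℕ.+ j))
  collision xs f f∈xs
    with i , j , i<j , eq ← pigeonhole ℕₚ.≤-refl (Any.index ∘ f∈xs)
    with k , 1+i+k≡j ← ℕₚ.m≤n⇒∃[o]m+o≡n i<j =
    toℕ i , k , trans (Anyₚ.lookup-index (f∈xs i))
      (trans (reflexive (cong (List.lookup xs) eq))
      (trans (sym (Anyₚ.lookup-index (f∈xs j))) (reflexive (cong f (≡.sym 1+i+k≡j)))))

  -- The first `suc (length xs)` values cannot all lie in `xs`. Excluded middle decides membership,
  -- so a bounded search finds one outside.
  avoid : ExcludedMiddle (c ⊔ˡ ℓ) → (f : ℕ → Carrier) →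
          (∀ i j → ¬ f i ≈ f (suc (i ℕ.+ j))) → ∀ xs → ∃[ k ] f k ∉ xs
  avoid em f distinct xs
    with i , fi∉xs ← ¬∀⟶∃¬ _ (λ i → f (toℕ i) ∈ xs) (λ _ → em)
      (λ f∈xs → let i , j , eq = collision xs f f∈xs in distinct i j eq) =
    toℕ i , fi∉xs

-- Sums, multiples and cancellation in a semigroup.

module _ (S : Semigroup c ℓ) where
  open Semigroup S renaming (_∙_ to _+_; refl to ≈-refl)
  open Membership setoid using (_∈_; _∉_)
  open SetoidReasoning setoid

  sum : (ℕ → Carrier) → List⁺ ℕ → Carrier
  sum x H = foldr₁ _+_ (map x H)

  sum-⁺∷ʳ : ∀ x H n → sum x (H ⁺∷ʳ n) ≈ sum x H + x n
  sum-⁺∷ʳ x (h ∷ t) n = go h t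
    where
    go : ∀ h t → sum x ((h ∷ t) ⁺∷ʳ n) ≈ sum x (h ∷ t) + x n
    go h []       = ≈-refl
    go h (h′ ∷ t) = trans (∙-congˡ (go h′ t)) (sym (assoc _ _ _))

  sum-interval : ∀ x m i j → sum x (interval m (suc (i ℕ.+ j))) ≈
                 sum x (interval m i) + sum x (interval (suc (i ℕ.+ m)) j)
  sum-interval x m zero    j = ≈-refl
  sum-interval x m (suc i) j rewrite ≡.sym (ℕₚ.+-suc i m) =
    trans (∙-congˡ (sum-interval x (suc m) i j)) (sym (assoc _ _ _))

  -- The (k + 1)-fold multiple of w: a semigroup has no 0-fold one.
  multiple : Carrier → ℕ → Carrier
  multiple w zero    = w
  multiple w (suc k) = w + multiple w k

  multiple-+ : ∀ w i j → multiple w (suc (i ℕ.+ j)) ≈ multiple w i + multiple w j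
  multiple-+ w zero    j = ≈-refl
  multiple-+ w (suc i) j = trans (∙-congˡ (multiple-+ w i j)) (sym (assoc _ _ _))

  absorb-multiple : ∀ {s w} → s + w ≈ s → ∀ k → s + multiple w k ≈ s
  absorb-multiple s+w≈s zero    = s+w≈s
  absorb-multiple s+w≈s (suc k) =
    trans (sym (assoc _ _ _)) (trans (∙-congʳ s+w≈s) (absorb-multiple s+w≈s k))

  module _ (noIdempotent : NoIdempotent S) (cancelʳ : RightCancellative S) where

    a+z≉z : ∀ a z → ¬ a + z ≈ z
    a+z≉z a z a+z≈z = noIdempotent (a , cancelʳ z (a + a) a (begin
      (a + a) + z  ≈⟨ assoc a a z ⟩
      a + (a + z)  ≈⟨ ∙-congˡ a+z≈z ⟩
      a + z        ∎))

    module _ (lwc : LeftWeaklyCancellative S) where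

      s+w≉s : ∀ s w → ¬ s + w ≈ s
      s+w≉s s w s+w≈s
        with i , j , eq ← collision setoid (proj₁ (lwc s s)) (multiple w)
                            (λ k → proj₂ (lwc s s) _ (absorb-multiple s+w≈s (toℕ k))) =
        a+z≉z (multiple w j) (multiple w i) (begin
          multiple w j + multiple w i   ≈⟨ multiple-+ w j i ⟨
          -- Multiples of `w` commute; the surplus `multiple w j` has to stand on the left to
          -- contradict `a+z≉z`.
          multiple w (suc (j ℕ.+ i))    ≡⟨ cong (multiple w ∘ suc) (ℕₚ.+-comm j i) ⟩
          multiple w (suc (i ℕ.+ j))    ≈⟨ eq ⟨
          multiple w i                  ∎)

      interval-sums-distinct : ∀ x m i j →
        ¬ sum x (interval m i) ≈ sum x (interval m (suc (i ℕ.+ j)))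
      interval-sums-distinct x m i j eq =
        s+w≉s _ _ (trans (sym (sum-interval x m i j)) (sym eq))

      forbidden : List Carrier → List Carrier
      forbidden F = F ++ concatMap (λ a → concatMap (λ b → proj₁ (lwc a b)) F) F

      -- Membership in `F` is only up to `≈`, so the equation is moved to the listed representatives
      -- `a′` and `b′`, whose solutions `forbidden F` contains.
      solution∈forbidden : ∀ {F a b z} → a ∈ F → b ∈ F → a + z ≈ b → z ∈ forbidden F
      solution∈forbidden {F} {z = z} a∈F b∈F a+z≈b =
        Membershipₚ.∈-++⁺ʳ setoid F (Anyₚ.concatMap⁺ _ (Any.map (λ {a′} a≈a′ →
          Anyₚ.concatMap⁺ _ (Any.map (λ {b′} b≈b′ → proj₂ (lwc a′ b′) z
            (trans (∙-congʳ (sym a≈a′)) (trans a+z≈b b≈b′))) b∈F)) a∈F))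

      -- The term `z` is added on the right because it carries the largest index.
      extend : List Carrier → Carrier → List Carrier
      extend F z = F ++ z ∷ List.map (_+ z) F

      -- Uniqueness of sums for a sequence of fresh terms.

      module _ (y : ℕ → Carrier) (F : ℕ → List Carrier)
               (F-suc : ∀ n → F (suc n) ≡ extend (F n) (y n))
               (fresh : ∀ n → y n ∉ forbidden (F n)) where

        sum∈F : Below n H → sum y H ∈ F n
        sum∈F {suc n} b rewrite F-suc n = go b
          where
          go : ∀ {H} → Below (suc n) H → sum y H ∈ extend (F n) (y n)
          go (skip b)         = Membershipₚ.∈-++⁺ˡ setoid (sum∈F b)
          go only             = Membershipₚ.∈-++⁺ʳ setoid (F n) (here ≈-refl)
          go (snoc {H = H} b) = Membershipₚ.∈-++⁺ʳ setoid (F n) (there (Anyₚ.map⁺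
            (Any.map (λ eq → trans (sum-⁺∷ʳ y H n) (∙-congʳ eq)) (sum∈F b))))

        sum≉y : Below n H → ¬ sum y H ≈ y n
        sum≉y b eq = fresh _
          (Membershipₚ.∈-++⁺ˡ setoid (Membershipₚ.∈-resp-≈ setoid eq (sum∈F b)))

        sum≉snoc : Below n H₁ → Below n H₂ → ¬ sum y H₁ ≈ sum y (H₂ ⁺∷ʳ n)
        sum≉snoc {H₂ = H₂} b₁ b₂ eq = fresh _ (solution∈forbidden (sum∈F b₂) (sum∈F b₁)
          (trans (sym (sum-⁺∷ʳ y H₂ _)) (sym eq)))

        y≉snoc : ∀ n H → ¬ y n ≈ sum y (H ⁺∷ʳ n)
        y≉snoc n H eq = a+z≉z (sum y H) (y n) (trans (sym (sum-⁺∷ʳ y H n)) (sym eq))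

        -- Compare the two lists at the largest admissible index `n`. If both append it to
        -- something, right cancellation removes it; if just one contains it, freshness of `y n`
        -- forbids equality; if just one is `[ n ]` and the other extends to `n`, `a+z≉z` does.
        sum-injective : Below n H₁ → Below n H₂ → sum y H₁ ≈ sum y H₂ → H₁ ≡ H₂
        sum-injective (skip b₁) (skip b₂) eq = sum-injective b₁ b₂ eq
        sum-injective (skip b₁) only      eq = ⊥-elim (sum≉y b₁ eq)
        sum-injective (skip b₁) (snoc b₂) eq = ⊥-elim (sum≉snoc b₁ b₂ eq)
        sum-injective only      (skip b₂) eq = ⊥-elim (sum≉y b₂ (sym eq))
        sum-injective only      only      eq = refl
        sum-injective only      (snoc {H = H₂} b₂) eq = ⊥-elim (y≉snoc _ H₂ eq)
        sum-injective (snoc b₁) (skip b₂) eq = ⊥-elim (sum≉snoc b₂ b₁ (sym eq))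
        sum-injective (snoc {H = H₁} b₁) only eq = ⊥-elim (y≉snoc _ H₁ (sym eq))
        sum-injective (snoc {n} {H₁} b₁) (snoc {H = H₂} b₂) eq =
          cong (_⁺∷ʳ n) (sum-injective b₁ b₂ (cancelʳ (y n) _ _
            (trans (sym (sum-⁺∷ʳ y H₁ n)) (trans eq (sum-⁺∷ʳ y H₂ n)))))

        uniqueFiniteSums : UniqueFiniteSums S y
        uniqueFiniteSums A B A≢B eq
          with m , a ← increasing⇒below (elements A) (increasing A)
             | n , b ← increasing⇒below (elements B) (increasing B) =
          A≢B (elements-injective (sum-injective
            -- Both lists are brought under the common bound `m ℕ.+ n`.
            (≡.subst (λ k → Below k (elements A)) (ℕₚ.+-comm n m) (below-raise n a))
            (below-raise m b) eq))

      -- Recursive choice of the blocks.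

      module _ (em : ExcludedMiddle (c ⊔ˡ ℓ)) (x : ℕ → Carrier) where

        avoiding : ∀ m T → ∃[ k ] sum x (interval m k) ∉ T
        avoiding m = avoid setoid em (sum x ∘ interval m) (interval-sums-distinct x m)

        -- The sums F formed so far together with the first unused index m.
        State : Set c
        State = List Carrier × ℕ

        blockLength : State → ℕ
        blockLength (F , m) = proj₁ (avoiding m (forbidden F))

        block : State → 𝒫f
        block s@(_ , m) = intervalSet m (blockLength s)

        next : State → State
        -- A block of length parameter `k` ends at index `k ℕ.+ m`, so the next one may start just
        -- after it.
        next s@(F , m) = extend F (∑ S x (block s)) , suc (blockLength s ℕ.+ m)

        state : ℕ → State
        state zero    = [] , 0
        state (suc n) = next (state n)

        subsystem : ℕ → Carrier
        subsystem n = ∑ S x (block (state n))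

        subsystem-isSumSubsystem : SumSubsystem S subsystem x
        subsystem-isSumSubsystem = block ∘ state , blocks-increase , λ _ → ≈-refl
          where
          blocks-increase : ∀ n → max (block (state n)) < min (block (state (suc n)))
          blocks-increase n = ℕₚ.≤-trans
            (s≤s (max-interval (proj₂ (state n)) (blockLength (state n))))
            (min-interval (proj₂ (state (suc n))) (blockLength (state (suc n))))

        subsystem-unique : UniqueFiniteSums S subsystem
        subsystem-unique = uniqueFiniteSums subsystem (proj₁ ∘ state) (λ _ → refl)
          (λ n → let F , m = state n in proj₂ (avoiding m (forbidden F)))

theorem2p4 : {c ℓ : Level} → ExcludedMiddle (c ⊔ˡ ℓ) →
    (S : Semigroup c ℓ) →
    Infinite S → NoIdempotent S →
    LeftWeaklyCancellative S → RightCancellative S →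
    (x : ℕ → Semigroup.Carrier S) →
    Σ[ y ∈ (ℕ → Semigroup.Carrier S) ] (SumSubsystem S y x × UniqueFiniteSums S y)
theorem2p4 em S _ noIdempotent lwc cancelʳ x =
  subsystem S noIdempotent cancelʳ lwc em x ,
  subsystem-isSumSubsystem S noIdempotent cancelʳ lwc em x ,
  subsystem-unique S noIdempotent cancelʳ lwc em x
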